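{- Let $\beta,\gamma\in\mathcal S_n$, where $\beta$ is a single $n$-cycle. Then $(\varepsilon,\beta,\gamma;(12))\in\mathrm{Par}(n)$ if and only if both of the following hold: <ul> <li>(i) the length of each cycle of $\gamma$ divides $2n$;</li> <li>(ii) at most one cycle of $\gamma$ has odd length.</li> </ul> Fixed points count as cycles of length $1$.
   Context: A Latin square of order $n$ is an $n\times n$ array with rows, columns and symbols indexed by $[n]$, each symbol occurring once in each row and each column, with triple set $O(L)$. Permutations act on the right; $\varepsilon$ is the identity. A paratopism $(\alpha,\beta,\gamma;(12))$ maps $L$ to $L^\sigma$ with triple set $\{(y\beta,x\alpha,z\gamma):(x,y,z)\in O(L)\}$; it is an autoparatopism of $L$ if $L^\sigma=L$. $\mathrm{Par}(n)$ is the set of paratopisms that are autoparatopisms of at least one Latin square of order $n$. -}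

module Defs where

open import Data.Fin using (Fin; zero; suc)
open import Data.Fin.Permutation using (Permutation′; _⟨$⟩ʳ_; _⟨$⟩ˡ_; transpose)
open import Data.Nat using (ℕ; _<_)
open import Data.Nat.Divisibility using (_∣_)
open import Data.Nat.GeneralisedArithmetic using (iterate)
open import Data.Product using (_×_; _,_; ∃; ∃-syntax; ∃!)
open import Level using (0ℓ)
open import Relation.Binary.PropositionalEquality using (_≡_; _≢_; refl)
open import Relation.Nullary using (¬_)
open import Relation.Unary using (Pred; _∈_; _≐_)

-- The index set [n] is Fin n throughout.

record LatinSquare (n : ℕ) : Set where
  field
    entry : Fin n → Fin n → Fin n
    row   : ∀ x z → ∃! _≡_ λ y → entry x y ≡ z
    col   : ∀ y z → ∃! _≡_ λ x → entry x y ≡ z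

Triple : ℕ → Set
Triple n = Fin n × Fin n × Fin n

O : ∀ {n} → LatinSquare n → Pred (Triple n) 0ℓ
O L (x , y , z) = LatinSquare.entry L x y ≡ z

pick : ∀ {A : Set} → A × A × A → Fin 3 → A
pick (a , b , c) zero             = a
pick (a , b , c) (suc zero)       = b
pick (a , b , c) (suc (suc zero)) = c

record Paratopism (n : ℕ) : Set where
  constructor ⟨_,_,_⨾_⟩
  field
    rowPerm colPerm symPerm : Permutation′ n
    coordPerm               : Permutation′ 3

-- Coordinate i is first moved by the i-th permutation and is then placed in
-- position iδ; hence position j receives the coordinate jδ⁻¹.
_·_ : ∀ {n} → Triple n → Paratopism n → Triple n
_·_ {n} t ⟨ α , β , γ ⨾ δ ⟩ = at zero , at (suc zero) , at (suc (suc zero))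
  where
  at : Fin 3 → Fin n
  at j = pick (α , β , γ) (δ ⟨$⟩ˡ j) ⟨$⟩ʳ pick t (δ ⟨$⟩ˡ j)

-- The transposition written (12) with 1-based coordinates.
[12] : Permutation′ 3
[12] = transpose zero (suc zero)

·-[12] : ∀ {n} (α β γ : Permutation′ n) x y z →
         (x , y , z) · ⟨ α , β , γ ⨾ [12] ⟩ ≡ (β ⟨$⟩ʳ y , α ⟨$⟩ʳ x , γ ⟨$⟩ʳ z)
·-[12] α β γ x y z = refl

-- The triple set of L^σ.
O^ : ∀ {n} → LatinSquare n → Paratopism n → Pred (Triple n) 0ℓ
O^ L σ t = ∃[ s ] s ∈ O L × s · σ ≡ t

IsAutoparatopism : ∀ {n} → Paratopism n → LatinSquare n → Set
IsAutoparatopism σ L = O^ L σ ≐ O L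

Par : ∀ n → Pred (Paratopism n) 0ℓ
Par n σ = ∃ λ (L : LatinSquare n) → IsAutoparatopism σ L

-- i π^k
pow : ∀ {n} → Permutation′ n → ℕ → Fin n → Fin n
pow π k i = iterate (π ⟨$⟩ʳ_) i k

SameCycle : ∀ {n} → Permutation′ n → Fin n → Fin n → Set
SameCycle π i j = ∃[ k ] pow π k i ≡ j

-- The cycle (i, iπ, iπ², …) of π through i has length ℓ.
CycleLength : ∀ {n} → Permutation′ n → Fin n → ℕ → Set
CycleLength π i ℓ =
  0 < ℓ × pow π ℓ i ≡ i × (∀ k → 0 < k → k < ℓ → pow π k i ≢ i)

-- A cycle of length n in S_n exhausts Fin n, so it is the only one.
IsSingleCycle : ∀ {n} → Permutation′ n → Set
IsSingleCycle {n} π = ∃[ i ] CycleLength π i n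

CycleLengthsDivide : ∀ {n} → Permutation′ n → ℕ → Set
CycleLengthsDivide π m = ∀ i ℓ → CycleLength π i ℓ → ℓ ∣ m

Odd : ℕ → Set
Odd ℓ = ¬ (2 ∣ ℓ)

-- Cycles are represented by their points; two points represent the same cycle
-- exactly when SameCycle holds.
AtMostOneOddCycle : ∀ {n} → Permutation′ n → Set
AtMostOneOddCycle π =
  ∀ i j ℓ m → CycleLength π i ℓ → CycleLength π j m →
  Odd ℓ → Odd m → SameCycle π i j

{-# OPTIONS --safe #-}
module Submission where

-- Index rows and columns by ℤ/n so that β is x ↦ x + 1, and let σ = (ε, β, γ; (12)), so that
-- σ fixes L iff L(y + 1, x) = γ L(x, y) for all x, y.  Then σ² is the translation by (1, 1)
-- combined with γ², and σ pairs the diagonal y - x = d with the diagonal y - x = -d - 1.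
--
-- Necessity.  σ²ⁿ fixes every cell, so γ²ⁿ is the identity.  A parity argument on the cells
-- holding a symbol of an odd cycle shows that one of them lies on a self-paired diagonal,
-- 2(y - x) + 1 = 0.  Hence n is odd, there is only one such diagonal, and as it is a single
-- orbit of translations its symbols lie in one cycle of γ.
--
-- Sufficiency.  L(a, b) = γ^(2a) Z(b - a) works for every bijection Z from ℤ/n to the symbols
-- with γ^(2d+1) Z(-d-1) = Z(d).  Such a Z is built from the middle outwards: the odd cycle of γ
-- (if any) is centred as c, γc, γ²c, …, and each even cycle, of length 2h, is then wrapped
-- around it, h symbols on either side.

open import Defs
import Algebra.Properties.CommutativeMonoid.Sum
open import Data.Fin using (Fin; toℕ; fromℕ<)
open import Data.Fin.Permutation using (Permutation′; id; permutation; _⟨$⟩ʳ_; _⟨$⟩ˡ_; inverseˡ; inverseʳ)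
open import Data.Fin.Properties using (all?; any?; ¬∀⟶∃¬; pigeonhole; injective⇒≤; toℕ-injective; toℕ<n; toℕ-fromℕ<)
import Data.Fin.Properties as Fin
open import Data.Nat using (ℕ; zero; suc; _+_; _*_; _∸_; _≤_; _<_; s≤s; z<s; NonZero; >-nonZero; ⌊_/2⌋; pred; _/_; _%_)
open import Data.Nat.Divisibility using (_∣_; divides; _∣?_; ∣m+n∣m⇒∣n; n∣m*n; m∣m*n; m%n≡0⇒n∣m; ∣-trans)
open import Data.Nat.DivMod using (m≡m%n+[m/n]*n; m%n<n; m<n⇒m%n≡m; [m+kn]%n≡m%n)
open import Data.Nat.Properties
open import Data.Nat.Tactic.RingSolver using (solve-∀)
open import Data.Product using (_×_; _,_; ∃; ∃!; ∃-syntax; proj₁; proj₂)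
open import Data.Sum using (_⊎_; inj₁; inj₂)
open import Data.Vec.Functional using (replicate)
open import Function.Base using (_∘_)
open import Function.Bundles using (_⇔_; mk⇔)
open import Relation.Binary.Definitions using (tri<; tri≈; tri>)
open import Relation.Binary.PropositionalEquality
open import Relation.Nullary using (¬_; Dec; yes; no; contradiction)
open import Relation.Nullary.Decidable using (decidable-stable; ¬?)
open import Relation.Unary using (_∈_; Decidable)

open ≡-Reasoning

-- Congruences

-- Multiples are added on both sides, so that no truncated subtraction enters.
record _≈_[mod_] (a b n : ℕ) : Set where
  constructor congruent
  field
    p q : ℕ
    eq  : a + p * n ≡ b + q * n

≈-reflexive : ∀ {a b n} → a ≡ b → a ≈ b [mod n ]
≈-reflexive refl = congruent 0 0 refl

≈-sym : ∀ {a b n} → a ≈ b [mod n ] → b ≈ a [mod n ]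
≈-sym (congruent p q eq) = congruent q p (sym eq)

≈-trans : ∀ {a b c n} → a ≈ b [mod n ] → b ≈ c [mod n ] → a ≈ c [mod n ]
≈-trans {a} {b} {c} {n} (congruent p q e) (congruent r s f) = congruent (p + r) (s + q) (begin
  a + (p + r) * n        ≡⟨ lemma a p r n ⟩
  (a + p * n) + r * n    ≡⟨ cong (_+ r * n) e ⟩
  (b + q * n) + r * n    ≡⟨ lemma₂ b q r n ⟩
  (b + r * n) + q * n    ≡⟨ cong (_+ q * n) f ⟩
  (c + s * n) + q * n    ≡⟨ sym (lemma c s q n) ⟩
  c + (s + q) * n        ∎)
  where
  lemma : ∀ a p r n → a + (p + r) * n ≡ (a + p * n) + r * n
  lemma = solve-∀
  lemma₂ : ∀ b q r n → (b + q * n) + r * n ≡ (b + r * n) + q * n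
  lemma₂ = solve-∀

≈-+ : ∀ {a b c d n} → a ≈ b [mod n ] → c ≈ d [mod n ] → (a + c) ≈ (b + d) [mod n ]
≈-+ {a} {b} {c} {d} {n} (congruent p q e) (congruent r s f) = congruent (p + r) (q + s) (begin
  (a + c) + (p + r) * n        ≡⟨ lemma a c p r n ⟩
  (a + p * n) + (c + r * n)    ≡⟨ cong₂ _+_ e f ⟩
  (b + q * n) + (d + s * n)    ≡⟨ sym (lemma b d q s n) ⟩
  (b + d) + (q + s) * n        ∎)
  where
  lemma : ∀ a c p r n → (a + c) + (p + r) * n ≡ (a + p * n) + (c + r * n)
  lemma = solve-∀

≈-+ˡ : ∀ {a b n} c → a ≈ b [mod n ] → (c + a) ≈ (c + b) [mod n ]
≈-+ˡ c = ≈-+ (≈-reflexive refl)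

≈-+ʳ : ∀ {a b n} c → a ≈ b [mod n ] → (a + c) ≈ (b + c) [mod n ]
≈-+ʳ c e = ≈-+ e (≈-reflexive refl)

≈-cancelˡ : ∀ c {a b n} → (c + a) ≈ (c + b) [mod n ] → a ≈ b [mod n ]
≈-cancelˡ c {a} {b} {n} (congruent p q e) = congruent p q (+-cancelˡ-≡ c _ _ (begin
  c + (a + p * n)  ≡⟨ sym (+-assoc c a _) ⟩
  c + a + p * n    ≡⟨ e ⟩
  c + b + q * n    ≡⟨ +-assoc c b _ ⟩
  c + (b + q * n)  ∎))

≈-cancelʳ : ∀ c {a b n} → (a + c) ≈ (b + c) [mod n ] → a ≈ b [mod n ]
≈-cancelʳ c {a} {b} e =
  ≈-cancelˡ c (≈-trans (≈-reflexive (+-comm c a)) (≈-trans e (≈-reflexive (+-comm b c))))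

≈-+-multiple : ∀ a k n → (a + k * n) ≈ a [mod n ]
≈-+-multiple a k n = congruent 0 k (+-identityʳ _)

≈-∣ : ∀ {a b m n} → m ∣ n → a ≈ b [mod n ] → a ≈ b [mod m ]
≈-∣ {a} {b} {m} (divides k refl) (congruent p q e) = congruent (p * k) (q * k) (begin
  a + p * k * m    ≡⟨ cong (a +_) (*-assoc p k m) ⟩
  a + p * (k * m)  ≡⟨ e ⟩
  b + q * (k * m)  ≡⟨ cong (b +_) (sym (*-assoc q k m)) ⟩
  b + q * k * m    ∎)

%-≈ : ∀ a n .{{_ : NonZero n}} → (a % n) ≈ a [mod n ]
%-≈ a n = ≈-sym (≈-trans (≈-reflexive (m≡m%n+[m/n]*n a n)) (≈-+-multiple (a % n) (a / n) n))

≈⇒% : ∀ {a b} n .{{_ : NonZero n}} → a ≈ b [mod n ] → a % n ≡ b % n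
≈⇒% {a} {b} n (congruent p q e) = begin
  a % n            ≡⟨ sym ([m+kn]%n≡m%n a p n) ⟩
  (a + p * n) % n  ≡⟨ cong (_% n) e ⟩
  (b + q * n) % n  ≡⟨ [m+kn]%n≡m%n b q n ⟩
  b % n            ∎

≈⇒≡ : ∀ {a b} n .{{_ : NonZero n}} → a < n → b < n → a ≈ b [mod n ] → a ≡ b
≈⇒≡ {a} {b} n a<n b<n e = begin
  a      ≡⟨ sym (m<n⇒m%n≡m a<n) ⟩
  a % n  ≡⟨ ≈⇒% n e ⟩
  b % n  ≡⟨ m<n⇒m%n≡m b<n ⟩
  b      ∎

≈-*ˡ : ∀ {a b n} c → a ≈ b [mod n ] → (c * a) ≈ (c * b) [mod n ]
≈-*ˡ zero    e = ≈-reflexive refl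
≈-*ˡ (suc c) e = ≈-+ e (≈-*ˡ c e)

-- Bridges the two moduli in play: positions are read modulo `n` (or `H`), exponents of γ modulo
-- twice that.
double-cong : ∀ {a b n} → a ≈ b [mod n ] → (2 * a) ≈ (2 * b) [mod 2 * n ]
double-cong {a} {b} {n} (congruent p q e) = congruent p q (begin
  2 * a + p * (2 * n)  ≡⟨ lemma a p n ⟩
  2 * (a + p * n)      ≡⟨ cong (2 *_) e ⟩
  2 * (b + q * n)      ≡⟨ sym (lemma b q n) ⟩
  2 * b + q * (2 * n)  ∎)
  where
  lemma : ∀ a p n → 2 * a + p * (2 * n) ≡ 2 * (a + p * n)
  lemma = solve-∀

-- `suc r` is the inverse of 2 modulo `n`, so the given equation is multiplied by it.
half-cong : ∀ {a b n} r → n ≡ 1 + 2 * r → (2 * a) ≈ (2 * b) [mod n ] → a ≈ b [mod n ]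
half-cong {a} {b} r refl (congruent p q e) = congruent (a + suc r * p) (b + suc r * q) (begin
  a + (a + suc r * p) * (1 + 2 * r)          ≡⟨ lemma a p r ⟩
  suc r * (2 * a + p * (1 + 2 * r))          ≡⟨ cong (suc r *_) e ⟩
  suc r * (2 * b + q * (1 + 2 * r))          ≡⟨ sym (lemma b q r) ⟩
  b + (b + suc r * q) * (1 + 2 * r)          ∎)
  where
  lemma : ∀ a p r → a + (a + (1 + r) * p) * (1 + 2 * r) ≡ (1 + r) * (2 * a + p * (1 + 2 * r))
  lemma = solve-∀

parity : ∀ n → (∃[ h ] n ≡ 2 * h) ⊎ (∃[ h ] n ≡ 1 + 2 * h)
parity zero = inj₁ (0 , refl)
parity (suc n) with parity n
... | inj₁ (h , refl) = inj₂ (h , refl)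
... | inj₂ (h , refl) = inj₁ (suc h , cong suc (sym (+-suc h (h + 0))))

odd⇒1+2* : ∀ {n} → Odd n → ∃[ h ] n ≡ 1 + 2 * h
odd⇒1+2* {n} odd with parity n
... | inj₁ (h , refl) = contradiction (m∣m*n h) odd
... | inj₂ r = r

-- With ℓ = 1 + 2k, one has nℓ = k(2n) + n, and ℓ divides both nℓ and k(2n).
odd-∣2*⇒∣ : ∀ {ℓ n} → Odd ℓ → ℓ ∣ 2 * n → ℓ ∣ n
odd-∣2*⇒∣ {ℓ} {n} odd ℓ∣2n with odd⇒1+2* odd
... | k , refl = ∣m+n∣m⇒∣n (subst (ℓ ∣_) (lemma n k) (n∣m*n n)) (∣-trans ℓ∣2n (n∣m*n k))
  where
  lemma : ∀ n k → n * (1 + 2 * k) ≡ k * (2 * n) + n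
  lemma = solve-∀

-- Involutions

module Σℕ = Algebra.Properties.CommutativeMonoid.Sum +-0-commutativeMonoid

indicator : ∀ {P : Set} → Dec P → ℕ
indicator (yes _) = 1
indicator (no _)  = 0

-- Without fixed points each `i` satisfies exactly one of `i < f i` and `f i < i`. Reindexing by `f`
-- exchanges the two kinds, so they are equally many.
involution-even : ∀ {n} (f : Fin n → Fin n) → (∀ i → f (f i) ≡ i) → (∀ i → f i ≢ i) → 2 ∣ n
involution-even {n} f inv f≢ = divides (Σℕ.sum up) (begin
  n                              ≡⟨ sym (sum-ones n) ⟩
  Σℕ.sum (replicate n 1)         ≡⟨ sym (Σℕ.sum-cong-≗ up+down) ⟩
  Σℕ.sum (λ i → up i + down i)   ≡⟨ Σℕ.∑-distrib-+ up down ⟩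
  Σℕ.sum up + Σℕ.sum down        ≡⟨ cong (Σℕ.sum up +_) down≡up ⟩
  Σℕ.sum up + Σℕ.sum up          ≡⟨ lemma (Σℕ.sum up) ⟩
  Σℕ.sum up * 2                  ∎)
  where
  up down : Fin n → ℕ
  up i   = indicator (i Fin.<? f i)
  down i = indicator (f i Fin.<? i)

  lemma : ∀ s → s + s ≡ s * 2
  lemma = solve-∀

  sum-ones : ∀ m → Σℕ.sum (replicate m 1) ≡ m
  sum-ones zero    = refl
  sum-ones (suc m) = cong suc (sum-ones m)

  up+down : ∀ i → up i + down i ≡ 1
  up+down i with i Fin.<? f i | f i Fin.<? i
  ... | yes i<fi | yes fi<i = contradiction fi<i (Fin.<-asym i<fi)
  ... | yes _    | no _     = refl
  ... | no _     | yes _    = refl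
  ... | no i≮fi  | no fi≮i  with Fin.<-cmp i (f i)
  ... | tri< i<fi _ _ = contradiction i<fi i≮fi
  ... | tri≈ _ i≡fi _ = contradiction (sym i≡fi) (f≢ i)
  ... | tri> _ _ fi<i = contradiction fi<i fi≮i

  down≡up : Σℕ.sum down ≡ Σℕ.sum up
  down≡up = begin
    Σℕ.sum down        ≡⟨ Σℕ.sum-permute down (permutation f f inv inv) ⟩
    Σℕ.sum (down ∘ f)  ≡⟨ Σℕ.sum-cong-≗ (λ i → cong (λ j → indicator (j Fin.<? f i)) (inv i)) ⟩
    Σℕ.sum up          ∎

odd-involution-fixed : ∀ {n} (f : Fin n → Fin n) → (∀ i → f (f i) ≡ i) → Odd n → ∃[ i ] f i ≡ i
odd-involution-fixed f inv odd with any? (λ i → f i Fin.≟ i)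
... | yes fixed = fixed
... | no ¬fixed = contradiction (involution-even f inv (λ i e → ¬fixed (i , e))) odd

-- Cycles

⟨$⟩ʳ-injective : ∀ {n} (π : Permutation′ n) {i j} → π ⟨$⟩ʳ i ≡ π ⟨$⟩ʳ j → i ≡ j
⟨$⟩ʳ-injective π {i} {j} e = begin
  i                      ≡⟨ sym (inverseˡ π) ⟩
  π ⟨$⟩ˡ (π ⟨$⟩ʳ i)     ≡⟨ cong (π ⟨$⟩ˡ_) e ⟩
  π ⟨$⟩ˡ (π ⟨$⟩ʳ j)     ≡⟨ inverseˡ π ⟩
  j                      ∎

module _ {n : ℕ} (π : Permutation′ n) where

  pow-+ : ∀ a b i → pow π (a + b) i ≡ pow π b (pow π a i)
  pow-+ zero    b i = refl
  pow-+ (suc a) b i = pow-+ a b (π ⟨$⟩ʳ i)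

  pow-suc : ∀ a i → pow π (suc a) i ≡ π ⟨$⟩ʳ pow π a i
  pow-suc a i = trans (cong (λ k → pow π k i) (+-comm 1 a)) (pow-+ a 1 i)

  pow-injective : ∀ a {i j} → pow π a i ≡ pow π a j → i ≡ j
  pow-injective zero    e = e
  pow-injective (suc a) e = ⟨$⟩ʳ-injective π (pow-injective a e)

  pow-fixed-* : ∀ {ℓ i} → pow π ℓ i ≡ i → ∀ k → pow π (k * ℓ) i ≡ i
  pow-fixed-* e zero = refl
  pow-fixed-* {ℓ} {i} e (suc k) = begin
    pow π (ℓ + k * ℓ) i        ≡⟨ pow-+ ℓ (k * ℓ) i ⟩
    pow π (k * ℓ) (pow π ℓ i)  ≡⟨ cong (pow π (k * ℓ)) e ⟩
    pow π (k * ℓ) i            ≡⟨ pow-fixed-* e k ⟩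
    i                          ∎

  pow-cong : ∀ {ℓ i a b} → pow π ℓ i ≡ i → a ≈ b [mod ℓ ] → pow π a i ≡ pow π b i
  pow-cong {ℓ} {i} {a} {b} e (congruent p q eq) = begin
    pow π a i                  ≡⟨ reduce a p ⟩
    pow π (a + p * ℓ) i        ≡⟨ cong (λ k → pow π k i) eq ⟩
    pow π (b + q * ℓ) i        ≡⟨ sym (reduce b q) ⟩
    pow π b i                  ∎
    where
    reduce : ∀ a p → pow π a i ≡ pow π (a + p * ℓ) i
    reduce a p = begin
      pow π a i                  ≡⟨ cong (pow π a) (sym (pow-fixed-* e p)) ⟩
      pow π a (pow π (p * ℓ) i)  ≡⟨ sym (pow-+ (p * ℓ) a i) ⟩
      pow π (p * ℓ + a) i        ≡⟨ cong (λ k → pow π k i) (+-comm (p * ℓ) a) ⟩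
      pow π (a + p * ℓ) i        ∎

  module _ {i ℓ} (cl : CycleLength π i ℓ) where

    private
      0<ℓ = proj₁ cl
      closes = proj₁ (proj₂ cl)
      minimal = proj₂ (proj₂ cl)
      instance
        ℓ≢0 : NonZero ℓ
        ℓ≢0 = >-nonZero 0<ℓ

    pow-% : ∀ a → pow π (a % ℓ) i ≡ pow π a i
    pow-% a = pow-cong closes (%-≈ a ℓ)

    pow-reduce : ∀ a → ∃[ r ] r < ℓ × pow π r i ≡ pow π a i
    pow-reduce a = a % ℓ , m%n<n a ℓ , pow-% a

    -- The remainder of `a` modulo `ℓ` is also a return time, and minimality of `ℓ` forces it to be
    -- 0.
    fixed⇒∣ : ∀ {a} → pow π a i ≡ i → ℓ ∣ a
    fixed⇒∣ {a} e with a % ℓ in eq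
    ... | zero  = m%n≡0⇒n∣m a ℓ eq
    ... | suc r = contradiction (trans (cong (λ k → pow π k i) (sym eq)) (trans (pow-% a) e))
                    (minimal (suc r) z<s (subst (_< ℓ) eq (m%n<n a ℓ)))

    pow-≡⇒≈-≤ : ∀ {a b} → a ≤ b → pow π a i ≡ pow π b i → a ≈ b [mod ℓ ]
    pow-≡⇒≈-≤ {a} {b} a≤b e with fixed⇒∣ (pow-injective a (begin
      pow π a (pow π (b ∸ a) i)  ≡⟨ sym (pow-+ (b ∸ a) a i) ⟩
      pow π (b ∸ a + a) i        ≡⟨ cong (λ k → pow π k i) (m∸n+n≡m a≤b) ⟩
      pow π b i                  ≡⟨ sym e ⟩
      pow π a i                  ∎))
    ... | divides k eq = ≈-sym (≈-trans (≈-reflexive (begin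
      b            ≡⟨ sym (m+[n∸m]≡n a≤b) ⟩
      a + (b ∸ a)  ≡⟨ cong (a +_) eq ⟩
      a + k * ℓ    ∎)) (≈-+-multiple a k ℓ))

    pow-≡⇒≈ : ∀ {a b} → pow π a i ≡ pow π b i → a ≈ b [mod ℓ ]
    pow-≡⇒≈ {a} {b} e with ≤-total a b
    ... | inj₁ a≤b = pow-≡⇒≈-≤ a≤b e
    ... | inj₂ b≤a = ≈-sym (pow-≡⇒≈-≤ b≤a (sym e))

    pow-injective-< : ∀ {a b} → a < ℓ → b < ℓ → pow π a i ≡ pow π b i → a ≡ b
    pow-injective-< a<ℓ b<ℓ = ≈⇒≡ ℓ a<ℓ b<ℓ ∘ pow-≡⇒≈

least : ∀ {P : ℕ → Set} → Decidable P → ∀ {k} → P k → ∃[ m ] P m × (∀ j → j < m → ¬ P j)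
least P? {k} pk with P? 0
... | yes p0 = 0 , p0 , λ _ ()
least P? {zero} pk | no ¬p0 = contradiction pk ¬p0
least {P} P? {suc k} pk | no ¬p0 with least {P ∘ suc} (P? ∘ suc) pk
... | m , pm , below = suc m , pm , λ where
  zero    _         → ¬p0
  (suc j) (s≤s j<m) → below j j<m

-- Two of the first `suc n` iterates of `i` agree; cancelling the earlier power leaves a positive
-- return time, and the least one is the length. Searching over `suc k` excludes the exponent 0.
cycle-length : ∀ {n} (π : Permutation′ n) i → ∃[ ℓ ] CycleLength π i ℓ
cycle-length {n} π i with pigeonhole {n} {suc n} ≤-refl (λ k → pow π (toℕ k) i)
... | a , b , a<b , e with least {λ k → pow π (suc k) i ≡ i} (λ k → pow π (suc k) i Fin.≟ i)
                             {toℕ b ∸ suc (toℕ a)} (pow-injective π (toℕ a) (begin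
  pow π (toℕ a) (pow π (suc d) i)  ≡⟨ sym (pow-+ π (suc d) (toℕ a) i) ⟩
  pow π (suc d + toℕ a) i          ≡⟨ cong (λ k → pow π k i) (sym (+-suc d (toℕ a))) ⟩
  pow π (d + suc (toℕ a)) i        ≡⟨ cong (λ k → pow π k i) (m∸n+n≡m a<b) ⟩
  pow π (toℕ b) i                  ≡⟨ sym e ⟩
  pow π (toℕ a) i                  ∎))
  where d = toℕ b ∸ suc (toℕ a)
... | ℓ , pℓ , below = suc ℓ , z<s , pℓ , λ where
  (suc k) _ (s≤s k<ℓ) → below k k<ℓ

-- Indexing by the powers of a full cycle

-- Prepending `z` to the values of `f` gives `suc n` elements of `Fin n`; as `f` is injective, a
-- collision must involve `z`.
injective⇒surjective : ∀ {n} (f : Fin n → Fin n) → (∀ {i j} → f i ≡ f j → i ≡ j) → ∀ z → ∃[ i ] f i ≡ z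
injective⇒surjective {n} f inj z with pigeonhole {n} {suc n} ≤-refl g
  where
  g : Fin (suc n) → Fin n
  g Fin.zero    = z
  g (Fin.suc i) = f i
... | Fin.zero  , Fin.suc j , _         , e = j , sym e
... | Fin.suc i , Fin.suc j , s≤s i<j , e = contradiction (cong toℕ (inj e)) (<⇒≢ i<j)

module Indexing {n : ℕ} (β : Permutation′ n) {i₀ : Fin n} (cl : CycleLength β i₀ n) where

  point : ℕ → Fin n
  point k = pow β k i₀

  point-cong : ∀ {a b} → a ≈ b [mod n ] → point a ≡ point b
  point-cong = pow-cong β (proj₁ (proj₂ cl))

  point-≡⇒≈ : ∀ {a b} → point a ≡ point b → a ≈ b [mod n ]
  point-≡⇒≈ = pow-≡⇒≈ β cl

  abstract
    point-surjective : ∀ x → ∃ λ (k : Fin n) → point (toℕ k) ≡ x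
    point-surjective = injective⇒surjective (point ∘ toℕ)
      (λ {i} {j} e → toℕ-injective (pow-injective-< β cl (toℕ<n i) (toℕ<n j) e))

  -- The discrete logarithm to the base β.
  index : Fin n → ℕ
  index x = toℕ (proj₁ (point-surjective x))

  point-index : ∀ x → point (index x) ≡ x
  point-index x = proj₂ (point-surjective x)

  point-suc : ∀ a → point (suc a) ≡ β ⟨$⟩ʳ point a
  point-suc a = pow-suc β a i₀

-- Necessity

module Necessity {n : ℕ} (β γ : Permutation′ n) {i₀ : Fin n} (cl : CycleLength β i₀ n)
                 (L : LatinSquare n) (auto : IsAutoparatopism ⟨ id , β , γ ⨾ [12] ⟩ L) where

  open Indexing β cl
  open LatinSquare L

  -- The square in exponent coordinates, where β becomes `suc`. Arguments are naturals rather than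
  -- residues; `M-cong` supplies the periodicity.
  M : ℕ → ℕ → Fin n
  M a b = entry (point a) (point b)

  M-cong : ∀ {a a′ b b′} → a ≈ a′ [mod n ] → b ≈ b′ [mod n ] → M a b ≡ M a′ b′
  M-cong e f = cong₂ entry (point-cong e) (point-cong f)

  M-injectiveʳ : ∀ a {b b′} → M a b ≡ M a b′ → b ≈ b′ [mod n ]
  M-injectiveʳ a {b} e with row (point a) (M a b)
  ... | _ , _ , unique = point-≡⇒≈ (trans (sym (unique refl)) (unique (sym e)))

  M-surjectiveʳ : ∀ a z → ∃[ b ] M a b ≡ z
  M-surjectiveʳ a z with row (point a) z
  ... | y , e , _ = index y , trans (cong (entry (point a)) (point-index y)) e

  M-reflect : ∀ a b → M (suc b) a ≡ γ ⟨$⟩ʳ M a b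
  M-reflect a b = trans (cong (λ x → entry x (point a)) (point-suc b))
                        (proj₁ auto ((point a , point b , M a b) , refl , refl))

  -- Two reflections restore the order of the coordinates, add 1 to each and apply γ twice.
  M-translate : ∀ t a b → M (t + a) (t + b) ≡ pow γ (2 * t) (M a b)
  M-translate zero    a b = refl
  M-translate (suc t) a b = begin
    M (suc (t + a)) (suc (t + b))           ≡⟨ M-reflect (suc (t + b)) (t + a) ⟩
    γ ⟨$⟩ʳ M (suc (t + b)) (t + a)          ≡⟨ cong (γ ⟨$⟩ʳ_) (M-reflect (t + a) (t + b)) ⟩
    pow γ 2 (M (t + a) (t + b))             ≡⟨ cong (pow γ 2) (M-translate t a b) ⟩
    pow γ 2 (pow γ (2 * t) (M a b))         ≡⟨ sym (pow-+ γ (2 * t) 2 (M a b)) ⟩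
    pow γ (2 * t + 2) (M a b)               ≡⟨ cong (λ k → pow γ k (M a b)) (lemma t) ⟩
    pow γ (2 * suc t) (M a b)               ∎
    where
    lemma : ∀ t → 2 * t + 2 ≡ 2 * (1 + t)
    lemma = solve-∀

  -- An odd power of the autoparatopism: one reflection, then `t` translations.
  M-glide : ∀ t a b → M (t + suc b) (t + a) ≡ pow γ (1 + 2 * t) (M a b)
  M-glide t a b = trans (M-translate t (suc b) a) (cong (pow γ (2 * t)) (M-reflect a b))

  -- The symbol `z` occurs in row 0; translating its cell by `n` returns to the same cell but
  -- applies the power `2 * n` of γ.
  lengths-divide : CycleLengthsDivide γ (2 * n)
  lengths-divide z ℓ clz with M-surjectiveʳ 0 z
  ... | b , refl = fixed⇒∣ γ clz (trans (sym (M-translate n 0 b)) (M-cong (n+ 0) (n+ b)))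
    where
    n+ : ∀ a → (n + a) ≈ a [mod n ]
    n+ a = ≈-trans (≈-reflexive (trans (+-comm n a) (cong (a +_) (sym (*-identityˡ n))))) (≈-+-multiple a 1 n)

  -- The ℓ-th power of the autoparatopism permutes the cells holding z; in terms of rows it
  -- acts as f below, with f (f x) ≡ x + ℓ.  So f induces an involution of the residues mod ℓ,
  -- and a fixed residue gives a cell on the diagonal that the autoparatopism maps to itself.
  odd⇒self-paired-diagonal : ∀ {z ℓ} → CycleLength γ z ℓ → Odd ℓ →
                        ∃[ x ] ∃[ y ] M x y ≡ z × (1 + 2 * y) ≈ (2 * x) [mod n ]
  odd⇒self-paired-diagonal {z} {ℓ} clz odd with odd⇒1+2* odd
  ... | k , refl = toℕ x₀ , θ (toℕ x₀) , M-θ (toℕ x₀) , diagonal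
    where
    ℓ∣n : ℓ ∣ n
    ℓ∣n = odd-∣2*⇒∣ odd (lengths-divide z ℓ clz)

    -- `θ x` is the column of `z` in row `x`. As ℓ = 1 + 2k, `M-glide k` moves the cell (x, θ x) to
    -- row `f x` and column `k + x`, again with symbol `z`.
    θ f : ℕ → ℕ
    θ x = proj₁ (M-surjectiveʳ x z)
    f x = k + suc (θ x)

    M-θ : ∀ x → M x (θ x) ≡ z
    M-θ x = proj₂ (M-surjectiveʳ x z)

    θ-unique : ∀ x {y} → M x y ≡ z → θ x ≈ y [mod n ]
    θ-unique x e = M-injectiveʳ x (trans (M-θ x) (sym e))

    f∘f : ∀ x → f (f x) ≈ (ℓ + x) [mod n ]
    f∘f x = ≈-trans (≈-+ˡ k (≈-+ˡ 1 (θ-unique (f x) (begin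
      M (f x) (k + x)         ≡⟨ M-glide k x (θ x) ⟩
      pow γ ℓ (M x (θ x))     ≡⟨ cong (pow γ ℓ) (M-θ x) ⟩
      pow γ ℓ z               ≡⟨ proj₁ (proj₂ clz) ⟩
      z                       ∎)))) (≈-reflexive (lemma k x))
      where
      lemma : ∀ k x → k + (1 + (k + x)) ≡ 1 + 2 * k + x
      lemma = solve-∀

    -- Translation by a multiple of `ℓ` preserves the symbol `z`, so `f` descends to residues modulo
    -- `ℓ`.
    f-multiple : ∀ j x → f (j * ℓ + x) ≈ (j * ℓ + f x) [mod n ]
    f-multiple j x = ≈-trans (≈-+ˡ k (≈-+ˡ 1 (θ-unique (j * ℓ + x) (begin
      M (j * ℓ + x) (j * ℓ + θ x)       ≡⟨ M-translate (j * ℓ) x (θ x) ⟩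
      pow γ (2 * (j * ℓ)) (M x (θ x))   ≡⟨ cong₂ (pow γ) (sym (*-assoc 2 j ℓ)) (M-θ x) ⟩
      pow γ (2 * j * ℓ) z               ≡⟨ pow-fixed-* γ (proj₁ (proj₂ clz)) (2 * j) ⟩
      z                                 ∎)))) (≈-reflexive (lemma k (j * ℓ) (θ x)))
      where
      lemma : ∀ k a b → k + (1 + (a + b)) ≡ a + (k + (1 + b))
      lemma = solve-∀

    f-% : ∀ x → f (x % ℓ) ≈ f x [mod ℓ ]
    f-% x = ≈-sym (≈-trans
      (≈-reflexive (cong f (trans (m≡m%n+[m/n]*n x ℓ) (+-comm (x % ℓ) _))))
      (≈-trans (≈-∣ ℓ∣n (f-multiple (x / ℓ) (x % ℓ)))
      (≈-trans (≈-reflexive (+-comm (x / ℓ * ℓ) _)) (≈-+-multiple _ (x / ℓ) ℓ))))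

    f̄ : Fin ℓ → Fin ℓ
    f̄ i = fromℕ< (m%n<n (f (toℕ i)) ℓ)

    toℕ-f̄ : ∀ i → toℕ (f̄ i) ≡ f (toℕ i) % ℓ
    toℕ-f̄ i = toℕ-fromℕ< (m%n<n (f (toℕ i)) ℓ)

    f̄-involutive : ∀ i → f̄ (f̄ i) ≡ i
    f̄-involutive i = toℕ-injective (begin
      toℕ (f̄ (f̄ i))            ≡⟨ toℕ-f̄ (f̄ i) ⟩
      f (toℕ (f̄ i)) % ℓ        ≡⟨ cong (λ k → f k % ℓ) (toℕ-f̄ i) ⟩
      f (f (toℕ i) % ℓ) % ℓ    ≡⟨ ≈⇒% ℓ (≈-trans (f-% (f (toℕ i))) (≈-∣ ℓ∣n (f∘f (toℕ i)))) ⟩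
      (ℓ + toℕ i) % ℓ          ≡⟨ cong (_% ℓ) (trans (+-comm ℓ (toℕ i)) (cong (toℕ i +_) (sym (*-identityˡ ℓ)))) ⟩
      (toℕ i + 1 * ℓ) % ℓ      ≡⟨ [m+kn]%n≡m%n (toℕ i) 1 ℓ ⟩
      toℕ i % ℓ                ≡⟨ m<n⇒m%n≡m (toℕ<n i) ⟩
      toℕ i                    ∎)

    x₀ : Fin ℓ
    x₀ = proj₁ (odd-involution-fixed f̄ f̄-involutive odd)

    j : ℕ
    j = f (toℕ x₀) / ℓ

    f-x₀ : f (toℕ x₀) ≡ j * ℓ + toℕ x₀
    f-x₀ = begin
      f (toℕ x₀)                   ≡⟨ m≡m%n+[m/n]*n (f (toℕ x₀)) ℓ ⟩
      f (toℕ x₀) % ℓ + j * ℓ       ≡⟨ +-comm _ (j * ℓ) ⟩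
      j * ℓ + f (toℕ x₀) % ℓ       ≡⟨ cong (j * ℓ +_) (sym (toℕ-f̄ x₀)) ⟩
      j * ℓ + toℕ (f̄ x₀)           ≡⟨ cong (λ i → j * ℓ + toℕ i)
                                       (proj₂ (odd-involution-fixed f̄ f̄-involutive odd)) ⟩
      j * ℓ + toℕ x₀               ∎

    -- Write f x = jℓ + x. Applying `f` again gives jℓ + f x ≈ f (f x) ≈ ℓ + x modulo `n`, hence 2 f
    -- x ≈ ℓ + 2x, while 2 f x = 1 + 2 θ x + ℓ.
    diagonal : (1 + 2 * θ (toℕ x₀)) ≈ (2 * toℕ x₀) [mod n ]
    diagonal = ≈-cancelʳ ℓ (≈-trans (≈-reflexive (begin
      1 + 2 * θ x + ℓ                 ≡⟨ lemma₁ (θ x) k ⟩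
      f x + f x                       ≡⟨ cong (f x +_) f-x₀ ⟩
      f x + (j * ℓ + x)               ≡⟨ lemma₂ (f x) (j * ℓ) x ⟩
      (j * ℓ + f x) + x               ∎))
      (≈-trans (≈-+ʳ x (≈-trans (≈-sym (f-multiple j x))
        (≈-trans (≈-reflexive (cong f (sym f-x₀))) (f∘f x))))
      (≈-reflexive (lemma₃ ℓ x))))
      where
      x = toℕ x₀
      lemma₁ : ∀ y k → 1 + 2 * y + (1 + 2 * k) ≡ (k + (1 + y)) + (k + (1 + y))
      lemma₁ = solve-∀
      lemma₂ : ∀ a b c → a + (b + c) ≡ (b + a) + c
      lemma₂ = solve-∀
      lemma₃ : ∀ l x → l + x + x ≡ 2 * x + l
      lemma₃ = solve-∀

  -- For even `n` the congruence of the self-paired diagonal contradicts parity. For odd `n` it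
  -- determines the column from the row, so some translation carries one cell to the other, and
  -- translations act on symbols by powers of γ.
  at-most-one-odd : AtMostOneOddCycle γ
  at-most-one-odd z z′ ℓ ℓ′ clz clz′ odd odd′
    with odd⇒self-paired-diagonal clz odd | odd⇒self-paired-diagonal clz′ odd′ | parity n
  ... | x , y , _ , congruent p q e | _ | inj₁ (r , n≡2r) =
    contradiction (trans (sym (factor₂ x q r)) (trans (cong (λ m → 2 * x + q * m) (sym n≡2r))
      (trans (sym e) (trans (cong (λ m → 1 + 2 * y + p * m) n≡2r) (factor₁ y p r)))))
      (even≢odd (x + q * r) (y + p * r))
    where
    factor₁ : ∀ y p r → 1 + 2 * y + p * (2 * r) ≡ 1 + 2 * (y + p * r)
    factor₁ = solve-∀
    factor₂ : ∀ x q r → 2 * x + q * (2 * r) ≡ 2 * (x + q * r)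
    factor₂ = solve-∀
  ... | x , y , refl , e | x′ , y′ , refl , e′ | inj₂ (r , n≡1+2r) = 2 * t , (begin
    pow γ (2 * t) (M x y)   ≡⟨ sym (M-translate t x y) ⟩
    M (t + x) (t + y)       ≡⟨ M-cong t+x≈x′ t+y≈y′ ⟩
    M x′ y′                 ∎)
    where
    -- Since 2r ≡ -1 modulo `n`, this represents x′ - x.
    t : ℕ
    t = x′ + 2 * r * x

    t+x≈x′ : (t + x) ≈ x′ [mod n ]
    t+x≈x′ = ≈-trans (≈-reflexive (trans (lemma x′ r x) (cong (λ m → x′ + x * m) (sym n≡1+2r))))
                     (≈-+-multiple x′ x n)
      where
      lemma : ∀ x′ r x → x′ + 2 * r * x + x ≡ x′ + x * (1 + 2 * r)
      lemma = solve-∀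

    t+y≈y′ : (t + y) ≈ y′ [mod n ]
    t+y≈y′ = half-cong r n≡1+2r (≈-cancelˡ 1
      (≈-trans (≈-reflexive (lemma₁ t y))
      (≈-trans (≈-+ˡ (2 * t) e)
      (≈-trans (≈-reflexive (lemma₂ t x))
      (≈-trans (≈-+ t+x≈x′ t+x≈x′)
      (≈-trans (≈-reflexive (lemma₃ x′)) (≈-sym e′)))))))
      where
      lemma₁ : ∀ t y → 1 + 2 * (t + y) ≡ 2 * t + (1 + 2 * y)
      lemma₁ = solve-∀
      lemma₂ : ∀ t x → 2 * t + 2 * x ≡ (t + x) + (t + x)
      lemma₂ = solve-∀
      lemma₃ : ∀ x → x + x ≡ 2 * x
      lemma₃ = solve-∀

-- Sufficiency

InjectiveBelow : ∀ {A : Set} → ℕ → (ℕ → A) → Set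
InjectiveBelow m w = ∀ {i j} → i < m → j < m → w i ≡ w j → i ≡ j

-- Concatenation for sequences represented by functions on ℕ of which only an initial segment
-- matters, so that lengths stay out of the types.
splice : ∀ {A : Set} → ℕ → (ℕ → A) → (ℕ → A) → ℕ → A
splice zero    u v i       = v i
splice (suc h) u v zero    = u 0
splice (suc h) u v (suc i) = splice h (u ∘ suc) v i

splice-< : ∀ {A : Set} h (u v : ℕ → A) {i} → i < h → splice h u v i ≡ u i
splice-< (suc h) u v {zero}  _         = refl
splice-< (suc h) u v {suc i} (s≤s i<h) = splice-< h (u ∘ suc) v i<h

splice-+ : ∀ {A : Set} h (u v : ℕ → A) i → splice h u v (h + i) ≡ v i
splice-+ zero    u v i = refl
splice-+ (suc h) u v i = splice-+ h (u ∘ suc) v i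

data Split (h m : ℕ) : ℕ → Set where
  below  : ∀ {i} → i < h → Split h m i
  beyond : ∀ {i} → i < m → Split h m (h + i)

split : ∀ h {m i} → i < h + m → Split h m i
split zero            i<m         = beyond i<m
split (suc h) {i = zero}  _       = below z<s
split (suc h) {i = suc i} (s≤s lt) with split h lt
... | below i<h  = below (s≤s i<h)
... | beyond i<m = beyond i<m

splice-injective : ∀ {A : Set} {h m} {u v : ℕ → A} → InjectiveBelow h u → InjectiveBelow m v →
                   (∀ {i j} → i < h → j < m → u i ≢ v j) → InjectiveBelow (h + m) (splice h u v)
splice-injective {h = h} {m} {u} {v} u-inj v-inj disjoint i< j< e with split h i< | split h j<
... | below i<h          | below j<h          =
  u-inj i<h j<h (trans (sym (splice-< h u v i<h)) (trans e (splice-< h u v j<h)))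
... | below i<h          | beyond {j} j<m     =
  contradiction (trans (sym (splice-< h u v i<h)) (trans e (splice-+ h u v j))) (disjoint i<h j<m)
... | beyond {i} i<m     | below j<h          =
  contradiction (trans (sym (splice-< h u v j<h)) (trans (sym e) (splice-+ h u v i))) (disjoint j<h i<m)
... | beyond {i} i<m     | beyond {j} j<m     =
  cong (h +_) (v-inj i<m j<m (trans (sym (splice-+ h u v i)) (trans e (splice-+ h u v j))))

-- Positions `i` and `j` among `m` are mirror images when `i + suc j ≡ m`; this exhibits the image
-- of `i` as a term.
complement : ∀ {i m} → i < m → i + suc (m ∸ suc i) ≡ m
complement {i} {m} i<m = trans (+-suc i _) (m+[n∸m]≡n i<m)

complement-unique : ∀ {i j k m} → i + suc j ≡ m → i + suc k ≡ m → j ≡ k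
complement-unique {i} e f = suc-injective (+-cancelˡ-≡ i _ _ (trans e (sym f)))

complement-comm : ∀ i j → i + suc j ≡ j + suc i
complement-comm i j = trans (+-suc i j) (trans (cong suc (+-comm i j)) (sym (+-suc j i)))

complement-< : ∀ i {j m} → i + suc j ≡ m → j < m
complement-< i {j} e = subst (j <_) e (m≤n+m (suc j) i)

-- Mirrored arrangements of the symbols

module Layouts {n : ℕ} (γ : Permutation′ n) (divides-2n : CycleLengthsDivide γ (2 * n)) where

  period : ∀ x → pow γ (2 * n) x ≡ x
  period x with cycle-length γ x
  ... | ℓ , cl with divides-2n x ℓ cl
  ... | divides k eq = trans (cong (λ m → pow γ m x) eq) (pow-fixed-* γ (proj₁ (proj₂ cl)) k)

  -- The middle m symbols of the row L(0, ·): with 2 g + m ≡ n, the symbol w i is meant for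
  -- column g + i, and mirrored says that the row is compatible with the reflection
  -- (0, d) ↦ (d + 1, 0) of the autoparatopism.
  record Layout (m : ℕ) : Set where
    field
      w         : ℕ → Fin n
      injective : InjectiveBelow m w

    Covered : Fin n → Set
    Covered x = ∃[ i ] i < m × w i ≡ x

    field
      -- Keeps the covered symbols a union of whole cycles.
      closed   : ∀ {x} → Covered x → Covered (γ ⟨$⟩ʳ x)
      -- Taking `g` as an argument avoids proving that n - m is even; the full layout uses `g` = 0.
      mirrored : ∀ g → 2 * g + m ≡ n → ∀ i j → i + suc j ≡ m →
                 pow γ (2 * g + (1 + 2 * i)) (w j) ≡ w i
      rest-even : ∀ x → ¬ Covered x → ∃[ h ] CycleLength γ x (2 * h)

    Covered? : Decidable Covered
    Covered? x = anyUpTo? (λ i → w i Fin.≟ x) m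

    closed-pow : ∀ a {x} → Covered x → Covered (pow γ a x)
    closed-pow zero    cov = cov
    closed-pow (suc a) cov = closed-pow a (closed cov)

    -- From any point of the cycle, further forward steps lead back to `c`, so closure would make
    -- `c` covered.
    uncovered-pow : ∀ {c ℓ} → CycleLength γ c ℓ → ¬ Covered c → ∀ a → ¬ Covered (pow γ a c)
    uncovered-pow {c} {suc ℓ} (_ , e , _) ¬cov a cov = ¬cov (subst Covered (begin
      pow γ (a * ℓ) (pow γ a c)  ≡⟨ sym (pow-+ γ a (a * ℓ) c) ⟩
      pow γ (a + a * ℓ) c        ≡⟨ cong (λ k → pow γ k c) (sym (*-suc a ℓ)) ⟩
      pow γ (a * suc ℓ) c        ≡⟨ pow-fixed-* γ e a ⟩
      c                          ∎) (closed-pow (a * ℓ) cov))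

    size≤n : m ≤ n
    size≤n = injective⇒≤ {f = w ∘ toℕ} (λ {i} {j} e → toℕ-injective (injective (toℕ<n i) (toℕ<n j) e))

    covered⇒n≤size : (∀ x → Covered x) → n ≤ m
    covered⇒n≤size cov = injective⇒≤ {f = λ x → fromℕ< (proj₁ (proj₂ (cov x)))} λ {x} {y} e → begin
      x                  ≡⟨ sym (proj₂ (proj₂ (cov x))) ⟩
      w (proj₁ (cov x))  ≡⟨ cong w (trans (sym (toℕ-fromℕ< _)) (trans (cong toℕ e) (toℕ-fromℕ< _))) ⟩
      w (proj₁ (cov y))  ≡⟨ proj₂ (proj₂ (cov y)) ⟩
      y                  ∎

  open Layout

  -- With q ≡ g + i (mod H), position i < H gets γ^(H+q) c and its mirror image gets
  -- γ^(H-1-q) c; the exponents differ by 2q + 1 ≡ 2(g + i) + 1 (mod 2H).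
  module Wrap {m} (W : Layout m) {c H} .{{_ : NonZero H}} (cl : CycleLength γ c (2 * H)) (fresh : ¬ Covered W c) where

    size g : ℕ
    size = H + (m + H)
    -- The symbols must be placed before any margin is supplied, so the margin is computed here;
    -- `g≡g′` identifies it with the one that `mirrored` receives.
    g    = ⌊ n ∸ size /2⌋

    abstract
      q : ℕ → ℕ
      q i = (g + i) % H

      q<H : ∀ i → q i < H
      q<H i = m%n<n (g + i) H

      q-≈ : ∀ i → q i ≈ (g + i) [mod H ]
      q-≈ i = %-≈ (g + i) H

      q-injective : InjectiveBelow H q
      q-injective {i} {j} i<H j<H e = ≈⇒≡ H i<H j<H (≈-cancelˡ g
        (≈-trans (≈-sym (%-≈ (g + i) H)) (≈-trans (≈-reflexive e) (%-≈ (g + j) H))))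

      q-surjective : ∀ {r} → r < H → ∃[ i ] i < H × q i ≡ r
      -- The witness represents r - g, because `pred H` ≡ -1 modulo `H`.
      q-surjective {r} r<H = (r + pred H * g) % H , m%n<n (r + pred H * g) H ,
        ≈⇒≡ H (q<H _) r<H (≈-trans (%-≈ _ H) (≈-trans (≈-+ˡ g (%-≈ (r + pred H * g) H))
          (≈-trans (≈-reflexive (trans (lemma g r (pred H)) (cong (λ k → r + g * k) (suc-pred H)))) (≈-+-multiple r g H))))
        where
        lemma : ∀ g r h → g + (r + h * g) ≡ r + g * (1 + h)
        lemma = solve-∀

    outer : ℕ → Fin n
    outer a = pow γ a c

    -- `left` uses the exponents from `H` to 2H - 1 and `right` those below `H`, so together they
    -- exhaust the cycle without overlap.
    left right w′ : ℕ → Fin n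
    left i  = outer (H + q i)
    right t = outer (H ∸ suc (q (H ∸ suc t)))
    w′ = splice H left (splice m (w W) right)

    H+q<2H : ∀ i → H + q i < 2 * H
    H+q<2H i = +-monoʳ-< H (≤-trans (q<H i) (m≤m+n H 0))

    H∸<H : ∀ t → H ∸ suc t < H
    H∸<H t = subst (H ∸ suc t <_) (suc-pred H)
      (s≤s (subst (_≤ pred H) (pred[m∸n]≡m∸[1+n] H t) (pred-mono-≤ (m∸n≤m H t))))

    <H⇒<2H : ∀ {t} → t < H → t < 2 * H
    <H⇒<2H t<H = ≤-trans t<H (m≤m+n H (H + 0))

    ∸-injective : InjectiveBelow H (λ t → H ∸ suc t)
    ∸-injective s<H t<H e = suc-injective (∸-cancelˡ-≡ s<H t<H e)

    left-injective : InjectiveBelow H left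
    left-injective {i} {j} i<H j<H e =
      q-injective i<H j<H (+-cancelˡ-≡ H _ _ (pow-injective-< γ cl (H+q<2H i) (H+q<2H j) e))

    right-injective : InjectiveBelow H right
    right-injective {s} {t} s<H t<H e = ∸-injective s<H t<H (q-injective (H∸<H s) (H∸<H t)
      (∸-injective (q<H (H ∸ suc s)) (q<H (H ∸ suc t))
        (pow-injective-< γ cl (<H⇒<2H (H∸<H (q (H ∸ suc s)))) (<H⇒<2H (H∸<H (q (H ∸ suc t)))) e)))

    left≢right : ∀ i t → left i ≢ right t
    left≢right i t e = <⇒≱ (H∸<H (q (H ∸ suc t)))
      (subst (H ≤_) (pow-injective-< γ cl (H+q<2H i) (<H⇒<2H (H∸<H (q (H ∸ suc t)))) e) (m≤m+n H (q i)))

    outer≢w : ∀ a {i} → i < m → outer a ≢ w W i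
    outer≢w a {i} i<m e = uncovered-pow W cl fresh a (i , i<m , sym e)

    w′-injective : InjectiveBelow size w′
    w′-injective = splice-injective left-injective
      (splice-injective (injective W) right-injective (λ {_} {t} i<m _ e → outer≢w (H ∸ suc (q (H ∸ suc t))) i<m (sym e)))
      left≢inner
      where
      left≢inner : ∀ {i j} → i < H → j < m + H → left i ≢ splice m (w W) right j
      left≢inner {i} i<H j< e with split m j<
      ... | below j<m      = outer≢w (H + q i) j<m (trans e (splice-< m _ right j<m))
      ... | beyond {j} _   = left≢right i j (trans e (splice-+ m _ right j))

    w′-left : ∀ {i} → i < H → w′ i ≡ left i
    w′-left = splice-< H left _

    w′-middle : ∀ {i} → i < m → w′ (H + i) ≡ w W i
    w′-middle {i} i<m = trans (splice-+ H left _ i) (splice-< m _ right i<m)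

    w′-right : ∀ t → w′ (H + (m + t)) ≡ right t
    w′-right t = trans (splice-+ H left _ (m + t)) (splice-+ m _ right t)

    Covered′ : Fin n → Set
    Covered′ x = ∃[ i ] i < size × w′ i ≡ x

    covered′-middle : ∀ {x} → Covered W x → Covered′ x
    covered′-middle (i , i<m , e) =
      H + i , +-monoʳ-< H (≤-trans i<m (m≤m+n m H)) , trans (w′-middle i<m) e

    H∸∸ : ∀ {i} → i < H → H ∸ suc (H ∸ suc i) ≡ i
    H∸∸ {i} i<H = trans (cong (_∸ suc (H ∸ suc i)) (sym (complement i<H))) (m+n∸n≡m i (suc (H ∸ suc i)))

    covered′-left : ∀ {r} → r < H → Covered′ (outer (H + r))
    covered′-left r<H with q-surjective r<H
    ... | i , i<H , e =
      i , ≤-trans i<H (m≤m+n H (m + H)) , trans (w′-left i<H) (cong (λ k → outer (H + k)) e)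

    covered′-right : ∀ {r} → r < H → Covered′ (outer r)
    covered′-right {r} r<H with q-surjective (H∸<H r)
    ... | i , i<H , e = H + (m + (H ∸ suc i)) , +-monoʳ-< H (+-monoʳ-< m (H∸<H i)) , (begin
      w′ (H + (m + (H ∸ suc i)))                    ≡⟨ w′-right (H ∸ suc i) ⟩
      outer (H ∸ suc (q (H ∸ suc (H ∸ suc i))))     ≡⟨ cong (λ k → outer (H ∸ suc (q k))) (H∸∸ i<H) ⟩
      outer (H ∸ suc (q i))                         ≡⟨ cong (λ k → outer (H ∸ suc k)) e ⟩
      outer (H ∸ suc (H ∸ suc r))                   ≡⟨ cong outer (H∸∸ r<H) ⟩
      outer r                                       ∎)

    covered′-outer : ∀ a → Covered′ (outer a)
    covered′-outer a with pow-reduce γ cl a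
    ... | b , b<2H , e = subst Covered′ e (cases (split H b<2H))
      where
      cases : ∀ {b} → Split H (H + 0) b → Covered′ (outer b)
      cases (below b<H)      = covered′-right b<H
      cases (beyond {r} r<H) = covered′-left (subst (r <_) (+-identityʳ H) r<H)

    closed′ : ∀ {x} → Covered′ x → Covered′ (γ ⟨$⟩ʳ x)
    closed′ (_ , i< , refl) = step (split H i<)
      where
      γ-outer : ∀ {x} a → x ≡ outer a → Covered′ (γ ⟨$⟩ʳ x)
      γ-outer a refl = subst Covered′ (pow-suc γ a c) (covered′-outer (suc a))

      step : ∀ {i} → Split H (m + H) i → Covered′ (γ ⟨$⟩ʳ w′ i)
      step {i} (below i<H) = γ-outer (H + q i) (w′-left i<H)
      step (beyond i<) with split m i<
      ... | below {i} i<m = covered′-middle (closed W (i , i<m , sym (w′-middle i<m)))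
      ... | beyond {t} _  = γ-outer (H ∸ suc (q (H ∸ suc t))) (w′-right t)

    module _ (g′ : ℕ) (eq : 2 * g′ + size ≡ n) where

      g≡g′ : g ≡ g′
      g≡g′ = begin
        ⌊ n ∸ size /2⌋               ≡⟨ cong (λ k → ⌊ k ∸ size /2⌋) (sym eq) ⟩
        ⌊ 2 * g′ + size ∸ size /2⌋   ≡⟨ cong ⌊_/2⌋ (m+n∸n≡m (2 * g′) size) ⟩
        ⌊ 2 * g′ /2⌋                 ≡⟨ cong (λ k → ⌊ g′ + k /2⌋) (+-identityʳ g′) ⟩
        ⌊ g′ + g′ /2⌋                ≡⟨ sym (n≡⌊n+n/2⌋ g′) ⟩
        g′                           ∎

      -- Doubling `q-≈` gives 2(g + i) ≡ 2 q i modulo 2H, the cycle length. Hence the exponent H - 1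
      -- - q i increases to H + q i.
      mirrored-left : ∀ i t → i + suc t ≡ H → pow γ (2 * g′ + (1 + 2 * i)) (right t) ≡ left i
      mirrored-left i t e rewrite sym g≡g′ = begin
        pow γ (2 * g + (1 + 2 * i)) (outer (H ∸ suc (q (H ∸ suc t))))  ≡⟨ cong (λ k → pow γ (2 * g + (1 + 2 * i)) (outer (H ∸ suc (q k)))) H∸suct≡i ⟩
        pow γ (2 * g + (1 + 2 * i)) (outer r)  ≡⟨ sym (pow-+ γ r _ c) ⟩
        outer (r + (2 * g + (1 + 2 * i)))      ≡⟨ pow-cong γ (proj₁ (proj₂ cl)) exponents ⟩
        outer (H + q i)                        ∎
        where
        r = H ∸ suc (q i)

        H∸suct≡i : H ∸ suc t ≡ i
        H∸suct≡i = trans (cong (_∸ suc t) (sym e)) (m+n∸n≡m i (suc t))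

        exponents : (r + (2 * g + (1 + 2 * i))) ≈ (H + q i) [mod 2 * H ]
        exponents = ≈-trans (≈-reflexive (lemma₁ r g i))
          (≈-trans (≈-+ˡ (1 + r) (≈-sym (double-cong (q-≈ i))))
          (≈-reflexive (trans (lemma₂ r (q i)) (cong (_+ q i) (complement (q<H i))))))
          where
          lemma₁ : ∀ r g i → r + (2 * g + (1 + 2 * i)) ≡ (1 + r) + 2 * (g + i)
          lemma₁ = solve-∀
          lemma₂ : ∀ r q → (1 + r) + 2 * q ≡ (q + (1 + r)) + q
          lemma₂ = solve-∀

      mirrored′ : ∀ i j → i + suc j ≡ size → pow γ (2 * g′ + (1 + 2 * i)) (w′ j) ≡ w′ i
      mirrored′ i j e = cases (split H (complement-< j (trans (complement-comm j i) e))) e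
        where
        cases : ∀ {i} → Split H (m + H) i → i + suc j ≡ size →
                pow γ (2 * g′ + (1 + 2 * i)) (w′ j) ≡ w′ i
        cases {i} (below i<H) e = begin
          pow γ (2 * g′ + (1 + 2 * i)) (w′ j)         ≡⟨ cong (pow γ (2 * g′ + (1 + 2 * i))) (trans (cong w′ j≡) (w′-right t)) ⟩
          pow γ (2 * g′ + (1 + 2 * i)) (right t)      ≡⟨ mirrored-left i t (complement i<H) ⟩
          left i                                      ≡⟨ sym (w′-left i<H) ⟩
          w′ i                                        ∎
          where
          t = H ∸ suc i
          lemma : ∀ i t H m → i + (1 + (H + (m + t))) ≡ H + (m + (i + (1 + t)))
          lemma = solve-∀
          j≡ : j ≡ H + (m + t)
          j≡ = complement-unique {i} e
            (trans (lemma i t H m) (cong (λ k → H + (m + k)) (complement i<H)))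
        cases (beyond i<) e with split m i<
        -- Seen from the inner layout, the margin is wider by the `H` new columns on each side.
        ... | below {i} i<m = begin
          pow γ (2 * g′ + (1 + 2 * (H + i))) (w′ j)   ≡⟨ cong₂ (pow γ) (lemma₁ g′ H i) (trans (cong w′ j≡) (w′-middle (complement-< i (complement i<m)))) ⟩
          pow γ (2 * (g′ + H) + (1 + 2 * i)) (w W k)  ≡⟨ mirrored W (g′ + H) (trans (lemma₂ g′ H m) eq) i k (complement i<m) ⟩
          w W i                                       ≡⟨ sym (w′-middle i<m) ⟩
          w′ (H + i)                                  ∎
          where
          k = m ∸ suc i
          lemma₁ : ∀ g H i → 2 * g + (1 + 2 * (H + i)) ≡ 2 * (g + H) + (1 + 2 * i)
          lemma₁ = solve-∀
          lemma₂ : ∀ g H m → 2 * (g + H) + m ≡ 2 * g + (H + (m + H))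
          lemma₂ = solve-∀
          lemma₃ : ∀ i k H → H + i + (1 + (H + k)) ≡ H + (i + (1 + k) + H)
          lemma₃ = solve-∀
          j≡ : j ≡ H + k
          j≡ = complement-unique {H + i} e
            (trans (lemma₃ i k H) (cong (λ k → H + (k + H)) (complement i<m)))
        -- The mirror image lies on the left. Going right to left and back adds up to the exponent
        -- `2 * n`, which acts trivially.
        ... | beyond {t} t<H = begin
          pow γ E (w′ j)                                  ≡⟨ cong (pow γ E) (trans (cong w′ j≡) (w′-left (complement-< t (complement t<H)))) ⟩
          pow γ E (left k)                                ≡⟨ cong (pow γ E) (sym (mirrored-left k t k+suct)) ⟩
          pow γ E (pow γ (2 * g′ + (1 + 2 * k)) (right t)) ≡⟨ sym (pow-+ γ (2 * g′ + (1 + 2 * k)) E (right t)) ⟩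
          pow γ (2 * g′ + (1 + 2 * k) + E) (right t)      ≡⟨ cong (λ a → pow γ a (right t)) exponents ⟩
          pow γ (2 * n) (right t)                         ≡⟨ period (right t) ⟩
          right t                                         ≡⟨ sym (w′-right t) ⟩
          w′ (H + (m + t))                                ∎
          where
          k = H ∸ suc t
          E = 2 * g′ + (1 + 2 * (H + (m + t)))
          k+suct : k + suc t ≡ H
          k+suct = trans (complement-comm k t) (complement t<H)
          lemma₁ : ∀ t k H m → H + (m + t) + (1 + k) ≡ H + (m + (t + (1 + k)))
          lemma₁ = solve-∀
          lemma₂ : ∀ g H m t k → 2 * g + (1 + 2 * k) + (2 * g + (1 + 2 * (H + (m + t)))) ≡ 2 * (2 * g + (H + (m + (k + (1 + t)))))
          lemma₂ = solve-∀
          exponents : 2 * g′ + (1 + 2 * k) + E ≡ 2 * n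
          exponents = trans (lemma₂ g′ H m t k)
            (cong (2 *_) (trans (cong (λ k → 2 * g′ + (H + (m + k))) k+suct) eq))
          j≡ : j ≡ k
          j≡ = complement-unique {H + (m + t)} e
            (trans (lemma₁ t k H m) (cong (λ k → H + (m + k)) (complement t<H)))

    wrapped : Layout size
    wrapped = record
      { w         = w′
      ; injective = w′-injective
      ; closed    = closed′
      ; mirrored  = mirrored′
      ; rest-even = λ x ¬cov → rest-even W x (¬cov ∘ covered′-middle)
      }

  -- Wraps cycles until every symbol is covered. Each wrap enlarges the layout, whose size cannot
  -- exceed `n`, so one unit of fuel per wrap suffices.
  complete : ∀ fuel {m} → Layout m → n ≤ m + fuel → Layout n
  complete fuel {m} W n≤ with all? (Covered? W)
  ... | yes cov = subst Layout (≤-antisym (size≤n W) (covered⇒n≤size W cov)) W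
  ... | no ¬cov with ¬∀⟶∃¬ n (Covered W) (Covered? W) ¬cov
  ... | c , fresh with rest-even W c fresh
  -- Half the length is a successor, since cycle lengths are positive.
  ... | suc h , cl with Wrap.wrapped W cl fresh
  complete zero {m} W n≤ | no _ | _ | suc h , _ | W′ =
    contradiction (≤-trans (size≤n W′) (subst (n ≤_) (+-identityʳ m) n≤))
      (<⇒≱ (s≤s (≤-trans (m≤m+n m (suc h)) (m≤n+m (m + suc h) h))))
  complete (suc fuel) {m} W n≤ | no _ | _ | suc h , _ | W′ = complete fuel W′
    (≤-trans n≤ (subst (_≤ suc h + (m + suc h) + fuel) (sym (+-suc m fuel))
      (+-monoˡ-≤ fuel (s≤s (≤-trans (m≤m+n m (suc h)) (m≤n+m (m + suc h) h))))))

  empty-layout : (∀ x → ∃[ h ] CycleLength γ x (2 * h)) → Fin n → Layout 0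
  empty-layout even x₀ = record
    -- An arbitrary value: there are no positions to fill.
    { w         = λ _ → x₀
    ; injective = λ ()
    ; closed    = λ { (_ , () , _) }
    ; mirrored  = λ _ _ i j e → contradiction e (m+1+n≢0 i)
    ; rest-even = λ x _ → even x
    }

  odd⊎even : ∀ x → (∃[ ℓ ] CycleLength γ x ℓ × Odd ℓ) ⊎ (∃[ h ] CycleLength γ x (2 * h))
  odd⊎even x with cycle-length γ x
  ... | ℓ , cl with 2 ∣? ℓ
  ... | no odd = inj₁ (ℓ , cl , odd)
  ... | yes (divides h refl) = inj₂ (h , subst (CycleLength γ x) (*-comm h 2) cl)

  -- Mirroring adds 2g + ℓ = n to the exponent `i`, and the odd number `ℓ` divides `n` because it
  -- divides `2 * n`. Any other odd cycle would coincide with this one, so the rest is even.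
  cycle-layout : AtMostOneOddCycle γ → ∀ {c ℓ} → CycleLength γ c ℓ → Odd ℓ → Layout ℓ
  cycle-layout one {c} {ℓ} cl odd = record
    { w         = λ i → pow γ i c
    ; injective = pow-injective-< γ cl
    ; closed    = λ { (i , _ , refl) → subst Covered₀ (pow-suc γ i c) (covered (suc i)) }
    ; mirrored  = mirrored₀
    ; rest-even = rest
    }
    where
    Covered₀ : Fin n → Set
    Covered₀ x = ∃[ i ] i < ℓ × pow γ i c ≡ x

    covered : ∀ a → Covered₀ (pow γ a c)
    covered = pow-reduce γ cl

    mirrored₀ : ∀ g → 2 * g + ℓ ≡ n → ∀ i j → i + suc j ≡ ℓ →
                pow γ (2 * g + (1 + 2 * i)) (pow γ j c) ≡ pow γ i c
    mirrored₀ g eq i j e with odd-∣2*⇒∣ odd (divides-2n c ℓ cl)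
    ... | divides k n≡kℓ = begin
      pow γ (2 * g + (1 + 2 * i)) (pow γ j c)   ≡⟨ sym (pow-+ γ j _ c) ⟩
      pow γ (j + (2 * g + (1 + 2 * i))) c       ≡⟨ cong (λ a → pow γ a c) (lemma g i j) ⟩
      pow γ (i + (2 * g + (i + suc j))) c       ≡⟨ cong (λ a → pow γ (i + (2 * g + a)) c) e ⟩
      pow γ (i + (2 * g + ℓ)) c                 ≡⟨ cong (λ a → pow γ (i + a) c) (trans eq n≡kℓ) ⟩
      pow γ (i + k * ℓ) c                       ≡⟨ pow-cong γ (proj₁ (proj₂ cl)) (≈-+-multiple i k ℓ) ⟩
      pow γ i c                                 ∎
      where
      lemma : ∀ g i j → j + (2 * g + (1 + 2 * i)) ≡ i + (2 * g + (i + (1 + j)))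
      lemma = solve-∀

    rest : ∀ x → ¬ Covered₀ x → ∃[ h ] CycleLength γ x (2 * h)
    rest x ¬cov with odd⊎even x
    ... | inj₂ even = even
    ... | inj₁ (ℓ′ , cl′ , odd′) with one c x ℓ ℓ′ cl cl′ odd odd′
    ... | a , refl = contradiction (covered a) ¬cov

  layout : AtMostOneOddCycle γ → Fin n → Layout n
  layout one x₀ with any? (λ x → ¬? (2 ∣? proj₁ (cycle-length γ x)))
  ... | yes (c , odd) = complete n (cycle-layout one (proj₂ (cycle-length γ c)) odd) (m≤n+m n _)
  ... | no ¬odd = complete n (empty-layout even x₀) ≤-refl
    where
    even : ∀ x → ∃[ h ] CycleLength γ x (2 * h)
    even x with cycle-length γ x in eq
    ... | ℓ , cl with decidable-stable (2 ∣? ℓ) (λ odd → ¬odd (x , subst (Odd ∘ proj₁) (sym eq) odd))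
    ... | divides h refl = h , subst (CycleLength γ x) (*-comm h 2) cl

-- The Latin square generated by its first row

module Sufficiency {n-1 : ℕ} (β γ : Permutation′ (suc n-1)) {i₀ : Fin (suc n-1)}
                   (cl : CycleLength β i₀ (suc n-1))
                   (divides-2n : CycleLengthsDivide γ (2 * suc n-1)) (one-odd : AtMostOneOddCycle γ) where

  n : ℕ
  n = suc n-1

  open Indexing β cl
  open Layouts γ divides-2n

  abstract
    firstRow : Layout n
    firstRow = layout one-odd i₀

  open Layout firstRow

  Z : ℕ → Fin n
  Z d = w (d % n)

  Z-cong : ∀ {d e} → d ≈ e [mod n ] → Z d ≡ Z e
  Z-cong d≈e = cong w (≈⇒% n d≈e)

  Z-injective : ∀ {d e} → Z d ≡ Z e → d ≈ e [mod n ]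
  Z-injective {d} {e} eq = ≈-trans (≈-sym (%-≈ d n))
    (≈-trans (≈-reflexive (injective (m%n<n d n) (m%n<n e n) eq)) (%-≈ e n))

  -- The case `g` = 0 of `mirrored`, carried from representatives below `n` to residues; the
  -- exponent may change by multiples of `2 * n`.
  Z-mirrored : ∀ {d e} → (d + suc e) ≈ 0 [mod n ] → pow γ (1 + 2 * d) (Z e) ≡ Z d
  Z-mirrored {d} {e} d+e+1≈0 = begin
    pow γ (1 + 2 * d) (Z e)      ≡⟨ cong (pow γ (1 + 2 * d)) (cong w e%n≡e₀) ⟩
    pow γ (1 + 2 * d) (w e₀)     ≡⟨ pow-cong γ (period (w e₀)) (≈-+ˡ 1 (double-cong (≈-sym (%-≈ d n)))) ⟩
    pow γ (1 + 2 * d₀) (w e₀)    ≡⟨ mirrored 0 refl d₀ e₀ d₀+e₀+1≡n ⟩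
    w d₀                         ∎
    where
    d₀ = d % n
    e₀ = n ∸ suc d₀

    d₀+e₀+1≡n : d₀ + suc e₀ ≡ n
    d₀+e₀+1≡n = complement (m%n<n d n)

    e%n≡e₀ : e % n ≡ e₀
    e%n≡e₀ = ≈⇒≡ n (m%n<n e n) (complement-< d₀ d₀+e₀+1≡n) (≈-trans (%-≈ e n)
      (≈-cancelˡ (suc d₀)
      (≈-trans (≈-reflexive (sym (+-suc d₀ e)))
      (≈-trans (≈-+ʳ (suc e) (%-≈ d n))
      (≈-trans d+e+1≈0
      (≈-trans (congruent 1 0 (trans (+-identityʳ n) (sym (+-identityʳ n))))
      (≈-reflexive (trans (sym d₀+e₀+1≡n) (+-suc d₀ e₀)))))))))

  -- b + n-1 * a stands for b - a modulo n.
  M : ℕ → ℕ → Fin n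
  M a b = pow γ (2 * a) (Z (b + n-1 * a))

  -- Changing `a` by a multiple of `n` changes the exponent by a multiple of `2 * n`, the common
  -- period of γ.
  M-congˡ : ∀ {a a′} b → a ≈ a′ [mod n ] → M a b ≡ M a′ b
  M-congˡ {a} {a′} b e = trans (cong (pow γ (2 * a)) (Z-cong (≈-+ˡ b (≈-*ˡ n-1 e))))
                               (pow-cong γ (period _) (double-cong e))

  M-injectiveʳ : ∀ a {b b′} → M a b ≡ M a b′ → b ≈ b′ [mod n ]
  M-injectiveʳ a e = ≈-cancelʳ (n-1 * a) (Z-injective (pow-injective γ (2 * a) e))

  M-reflect : ∀ a b → M (suc b) a ≡ γ ⟨$⟩ʳ M a b
  M-reflect a b = sym (begin
    γ ⟨$⟩ʳ pow γ (2 * a) (Z d)               ≡⟨ sym (pow-suc γ (2 * a) (Z d)) ⟩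
    pow γ (1 + 2 * a) (Z d)                  ≡⟨ cong (pow γ (1 + 2 * a)) (sym (Z-mirrored {d} {e} d+e+1≈0)) ⟩
    pow γ (1 + 2 * a) (pow γ (1 + 2 * d) (Z e))  ≡⟨ sym (pow-+ γ (1 + 2 * d) (1 + 2 * a) (Z e)) ⟩
    pow γ (1 + 2 * d + (1 + 2 * a)) (Z e)    ≡⟨ pow-cong γ (period (Z e)) exponents ⟩
    pow γ (2 * suc b) (Z e)                  ∎)
    where
    -- These represent b - a and a - (b + 1), so e ≡ -d - 1, as `Z-mirrored` requires.
    d = b + n-1 * a
    e = a + n-1 * suc b

    d+e+1≈0 : (d + suc e) ≈ 0 [mod n ]
    d+e+1≈0 = ≈-trans (≈-reflexive (lemma a b n-1)) (≈-+-multiple 0 (a + b + 1) n)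
      where
      lemma : ∀ a b k → b + k * a + (1 + (a + k * (1 + b))) ≡ 0 + (a + b + 1) * (1 + k)
      lemma = solve-∀

    exponents : (1 + 2 * d + (1 + 2 * a)) ≈ (2 * suc b) [mod 2 * n ]
    exponents = ≈-trans (≈-reflexive (lemma a b n-1)) (≈-+-multiple (2 * suc b) a (2 * n))
      where
      lemma : ∀ a b k → 1 + 2 * (b + k * a) + (1 + 2 * a) ≡ 2 * (1 + b) + a * (2 * (1 + k))
      lemma = solve-∀

  entry : Fin n → Fin n → Fin n
  entry x y = M (index x) (index y)

  entry-reflect : ∀ x y → entry (β ⟨$⟩ʳ y) x ≡ γ ⟨$⟩ʳ entry x y
  entry-reflect x y = trans (M-congˡ {index (β ⟨$⟩ʳ y)} {suc (index y)} (index x) (point-≡⇒≈ (begin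
    point (index (β ⟨$⟩ʳ y))  ≡⟨ point-index (β ⟨$⟩ʳ y) ⟩
    β ⟨$⟩ʳ y                  ≡⟨ cong (β ⟨$⟩ʳ_) (sym (point-index y)) ⟩
    β ⟨$⟩ʳ point (index y)    ≡⟨ sym (point-suc (index y)) ⟩
    point (suc (index y))     ∎))) (M-reflect (index x) (index y))

  entry-injectiveʳ : ∀ x {y y′} → entry x y ≡ entry x y′ → y ≡ y′
  entry-injectiveʳ x {y} {y′} e = begin
    y                 ≡⟨ sym (point-index y) ⟩
    point (index y)   ≡⟨ point-cong (M-injectiveʳ (index x) {index y} {index y′} e) ⟩
    point (index y′)  ≡⟨ point-index y′ ⟩
    y′                ∎

  -- The reflection turns column `y` into row yβ, reducing the claim to injectivity along rows.
  entry-injectiveˡ : ∀ y {x x′} → entry x y ≡ entry x′ y → x ≡ x′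
  entry-injectiveˡ y {x} {x′} e = entry-injectiveʳ (β ⟨$⟩ʳ y)
    (trans (entry-reflect x y) (trans (cong (γ ⟨$⟩ʳ_) e) (sym (entry-reflect x′ y))))

  square : LatinSquare n
  square = record
    { entry = entry
    ; row   = λ x z → unique (entry-injectiveʳ x) z
    ; col   = λ y z → unique (entry-injectiveˡ y) z
    }
    where
    unique : ∀ {f : Fin n → Fin n} → (∀ {i j} → f i ≡ f j → i ≡ j) → ∀ z → ∃! _≡_ λ i → f i ≡ z
    unique {f} inj z with injective⇒surjective f inj z
    ... | i , e = i , e , λ e′ → inj (trans e (sym e′))

  square-auto : IsAutoparatopism ⟨ id , β , γ ⨾ [12] ⟩ square
  square-auto = (λ { ((x , y , _) , refl , refl) → entry-reflect x y })
    -- The preimage of the triple: the coordinates swap back, with β and γ inverted.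
    , λ { {x , y , z} e → (y , β ⟨$⟩ˡ x , γ ⟨$⟩ˡ z)
        , ⟨$⟩ʳ-injective γ (begin
            γ ⟨$⟩ʳ entry y (β ⟨$⟩ˡ x)      ≡⟨ sym (entry-reflect y (β ⟨$⟩ˡ x)) ⟩
            entry (β ⟨$⟩ʳ (β ⟨$⟩ˡ x)) y    ≡⟨ cong (λ u → entry u y) (inverseʳ β {x}) ⟩
            entry x y                      ≡⟨ e ⟩
            z                              ≡⟨ sym (inverseʳ γ) ⟩
            γ ⟨$⟩ʳ (γ ⟨$⟩ˡ z)              ∎)
        , cong₂ (λ u v → u , y , v) (inverseʳ β) (inverseʳ γ) }

theorem4p8 : ∀ (n : ℕ) (β γ : Permutation′ n) → IsSingleCycle β →
    (⟨ id , β , γ ⨾ [12] ⟩ ∈ Par n) ⇔ (CycleLengthsDivide γ (2 * n) × AtMostOneOddCycle γ)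
theorem4p8 zero      β γ (() , _)
theorem4p8 n@(suc _) β γ (i₀ , cl) = mk⇔
  (λ (L , auto) → let open Necessity β γ cl L auto in lengths-divide , at-most-one-odd)
  (λ (divides-2n , one-odd) → let open Sufficiency β γ cl divides-2n one-odd in square , square-auto)
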